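{- There is a polynomial $p$ such that for every $N\ge1$, every DLDS $\mathcal D$ with exactly $N$ distinct formula labels, every number of transitions $1\le h\le N$ (so that the circuit grid has $N$ columns and at most $N+1$ levels), and every goal column $c\in\{1,\dots,N\}$, the function $P\mapsto \mathrm{acc}_{\mathcal D,c}(P)$ on $\mathsf{Path}_{N,h}$ (path assignments being encoded in binary) is computed by a Boolean circuit of size at most $p(N)$.
   Context: **Formulas and DLDS.** Formulas are built from propositional atoms using only implication $\supset$. Fix a set $\Gamma$ of formulas, a linear order $\mathcal O_\Gamma$ on it, and let $\mathcal O_\Gamma^0=\mathcal O_\Gamma\cup\{0,\lambda\}$ with $0,\lambda$ fresh symbols. A DLDS (Dag-Like Derivability Structure) is a tuple $\mathcal D=\langle V,r,l,(E_D^i)_{i\in\mathcal O_\Gamma^0},E_A,L_D,P_A\rangle$ where $V$ is a nonempty finite set of nodes, $r\in V$ is the root, $l:V\to\Gamma$ labels nodes by formulas, $E_D^i\subseteq V\times V$ is the set of deduction edges of colour $i$, $E_A\subseteq V\times V$ is the set of ancestor edges, $L_D:\bigcup_i E_D^i\to\{0,1\}^{|\mathcal O_\Gamma|}$ labels deduction edges with bitstrings, and $P_A:E_A\to(\mathcal O_\Gamma^0)^*$ labels ancestor edges with finite colour paths. What follows depends on $\mathcal D$ only through its set of formula labels $l(V)=\{\varphi_1,\dots,\varphi_N\}$, listed in the order induced by $\mathcal O_\Gamma$ without repetition. **Grid and rule instances.** The grid has levels $0,\dots,h$ and one cell $(i,j)$ for each level $i$ and column $j\in\{1,\dots,N\}$;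 column $j$ carries formula $\varphi_j$. A dependency vector is an element of $\{0,1\}^N$; $e_j$ is the one-hot vector at $j$. The candidate rule instances at a cell $(i,j)$, $i\ge1$, are: - repetition: one premise, column $j$; result on input $\vec d$ is $\vec d$; - implication introduction, when $\varphi_j=\alpha\supset\varphi_b$: one premise, column $b$; result $\vec d\wedge\neg\chi_\alpha$, where $\chi_\alpha=e_a$ if $\alpha=\varphi_a$, and $\chi_\alpha=\vec0$ if $\alpha$ is not among the $\varphi$'s; - implication elimination, for every pair $(a,k)$ with $\varphi_k=\varphi_a\supset\varphi_j$: two premises, columns $a$ and $k$; result $\vec d_1\vee\vec d_2$ (bitwise) on inputs $\vec d_1,\vec d_2$. An input position of a cell is a pair (rule instance, one of its premises). Each cell has at most $2N+2$ positions; fix the label set $\mathsf L=\{1,\dots,2N+2\}$ and, for each column, an injective naming of the input positions by labels (unused labels name no position). **Path assignments.** $\mathsf{Path}_{N,h}=\bigl((\{0,\dots,N\}\times\mathsf L)^h\bigr)^N$. So $P=(\mathrm{Path}_1,\dots,\mathrm{Path}_N)$, each $\mathrm{Path}_o=[(t_0,\ell_0),\dots,(t_{h-1},\ell_{h-1})]$. For each origin column $o$ a token starts at cell $(0,o)$. If the token is at column $s$ of level $i$ and $t_i=0$, it stops permanently; if $t_i=j\in\{1,\dots,N\}$, it moves to cell $(i+1,j)$, arriving with source column $s$ and label $\ell_i$. A cell $(i,j)$ with $i\ge1$ is active if at least one token arrives there. In the binary encoding of $P$, each $t_i$ and each $\ell_i$ is written in binary with a fixed number of bits ($\lceil\log_2(N+1)\rceil$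 and $\lceil\log_2(2N+3)\rceil$ respectively); the circuit need only be correct on inputs that encode elements of $\mathsf{Path}_{N,h}$. **Activation and validity.** A token arriving at $(i,j)$ activates an input position if its label names that position and its source column equals the premise column of that position. A rule instance at $(i,j)$ is active if all of its input positions are activated. The selected inputs at an active cell determine exactly one admissible rule instance if exactly one rule instance at that cell is active and every token arriving at the cell activates an input position of that instance. **Dependency vectors.** $\vec d_{0,j}=e_j$. For $i\ge1$: if exactly one rule instance at $(i,j)$ is active, $\vec d_{i,j}$ is the result of that instance applied to the vectors $\vec d_{i-1,s}$ of its premise columns $s$; otherwise $\vec d_{i,j}=\vec0$. **Acceptance.** $\mathrm{Invalid}_{\mathcal D}(P)$: at some active cell the selected inputs do not determine exactly one admissible rule instance. $\mathrm{WellFormed}_{\mathcal D}(P)$: at every active cell they do. $\mathrm{Discharged}_{\mathcal D,c}(P)$: $\vec d_{h,c}=\vec0$. The acceptance bit $\mathrm{acc}_{\mathcal D,c}(P)\in\{0,1\}$ is $1$ iff $\mathrm{Invalid}_{\mathcal D}(P)\vee(\mathrm{WellFormed}_{\mathcal D}(P)\wedge\mathrm{Discharged}_{\mathcal D,c}(P))$. **Circuit size** is the number of gates over the basis of NOT and fan-in-two AND and OR gates, with constants $0,1$ available. -}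

module Defs where

open import Data.Bool using (Bool; true; false; not; _∧_; _∨_)
import Data.Bool.Properties as Bool
open import Data.Fin using (Fin; zero; suc; toℕ; inject₁; fromℕ<) renaming (_<_ to _<ᶠ_)
open import Data.Fin.Properties using (any?; all?) renaming (_≟_ to _≟ᶠ_)
open import Data.List using (List; []; _∷_)
open import Data.Maybe using (Maybe; just; nothing)
import Data.Maybe.Properties as Maybe
open import Data.Nat using (ℕ; zero; suc; _+_; _*_; _≤_; _≡ᵇ_; ⌊_/2⌋; _%_)
open import Data.Nat.Logarithm using (⌈log₂_⌉)
open import Data.Nat.Properties using (≤-refl; <⇒≤) renaming (_≟_ to _≟ℕ_)
open import Data.Product using (Σ; ∃; ∃-syntax; _×_; _,_; proj₁)
import Data.Product.Properties as Product
open import Data.Sum using (_⊎_; inj₁; inj₂)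
open import Data.Vec using (Vec; []; _∷_; lookup; replicate; zipWith; concat; map; _++_; _[_]≔_)
import Data.Vec.Properties as Vec
open import Function using (_⇔_)
open import Function.Definitions using (Injective)
open import Level using (0ℓ)
open import Relation.Binary using (Rel; IsTotalOrder; DecidableEquality)
open import Relation.Binary.PropositionalEquality using (_≡_; _≢_; refl; sym; trans; cong; cong₂; subst)
open import Relation.Nullary using (Dec; yes; no; ¬_; ¬?; recompute)
open import Relation.Nullary.Decidable using (⌊_⌋; map′; _×-dec_; _⊎-dec_; _→-dec_; decidable-stable)

-- A polynomial is its list of coefficients, constant term first.
Polynomial : Set
Polynomial = List ℕ

evalPoly : Polynomial → ℕ → ℕ
evalPoly []       x = 0
evalPoly (a ∷ as) x = a + x * evalPoly as x

data Source (n g : ℕ) : Set where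
  input    : Fin n → Source n g
  gate     : Fin g → Source n g
  constant : Bool → Source n g

data Gate (n g : ℕ) : Set where
  NOT : Source n g → Gate n g
  AND : Source n g → Source n g → Gate n g
  OR  : Source n g → Source n g → Gate n g

-- A circuit is a topologically ordered list of gates with unrestricted
-- fan-out; `gate zero` refers to the most recently added gate.
data Gates (n : ℕ) : ℕ → Set where
  []  : Gates n 0
  _▷_ : ∀ {g} → Gates n g → Gate n g → Gates n (suc g)

record Circuit (n : ℕ) : Set where
  field
    size   : ℕ
    gates  : Gates n size
    output : Source n size

open Circuit public

evalSource : ∀ {n g} → Vec Bool n → Vec Bool g → Source n g → Bool
evalSource xs vs (input i)    = lookup xs i
evalSource xs vs (gate k)     = lookup vs k
evalSource xs vs (constant b) = b

evalGate : ∀ {n g} → Vec Bool n → Vec Bool g → Gate n g → Bool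
evalGate xs vs (NOT s)   = not (evalSource xs vs s)
evalGate xs vs (AND s t) = evalSource xs vs s ∧ evalSource xs vs t
evalGate xs vs (OR s t)  = evalSource xs vs s ∨ evalSource xs vs t

evalGates : ∀ {n g} → Gates n g → Vec Bool n → Vec Bool g
evalGates []       xs = []
evalGates (gs ▷ γ) xs = let vs = evalGates gs xs in evalGate xs vs γ ∷ vs

evalCircuit : ∀ {n} → Circuit n → Vec Bool n → Bool
evalCircuit C xs = evalSource xs (evalGates (gates C) xs) (output C)

infixr 6 _⊃_

data Formula : Set where
  atom : ℕ → Formula
  _⊃_  : Formula → Formula → Formula

⊃-injective : ∀ {α β γ δ} → α ⊃ β ≡ γ ⊃ δ → α ≡ γ × β ≡ δ
⊃-injective refl = refl , refl

_≟_ : DecidableEquality Formula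
atom m  ≟ atom n  = map′ (cong atom) (λ { refl → refl }) (m ≟ℕ n)
atom m  ≟ (γ ⊃ δ) = no λ ()
(α ⊃ β) ≟ atom n  = no λ ()
(α ⊃ β) ≟ (γ ⊃ δ) =
  map′ (λ (p , q) → cong₂ _⊃_ p q) ⊃-injective ((α ≟ γ) ×-dec (β ≟ δ))

-- A set of formulas, presented as an injective family, with a linear order.
record OrderedFormulaSet : Set₁ where
  field
    Carrier      : Set
    formula      : Carrier → Formula
    formula-inj  : Injective _≡_ _≡_ formula
    _≼_          : Rel Carrier 0ℓ
    isTotalOrder : IsTotalOrder _≡_ _≼_

module _ (Γ : OrderedFormulaSet) where
  open OrderedFormulaSet Γ

  data Colour : Set where
    ordinary : Carrier → Colour
    zeroᶜ    : Colour
    lambdaᶜ  : Colour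

  -- The node set is taken to be Fin ∣V∣; it is nonempty because of `root`.
  -- The edge proofs given to `L-D` and `P-A` are irrelevant, so that the
  -- labels depend on the edge alone.  A bitstring in {0,1}^|𝒪_Γ| is a
  -- function from Γ to Bool.
  record DLDS : Set₁ where
    field
      ∣V∣  : ℕ

    V : Set
    V = Fin ∣V∣

    field
      root : V
      l    : V → Carrier
      E-D  : Colour → Rel V 0ℓ
      E-A  : Rel V 0ℓ
      L-D  : ∀ u v → .(∃[ i ] E-D i u v) → Carrier → Bool
      P-A  : ∀ u v → .(E-A u v) → List Colour

module _ {Γ : OrderedFormulaSet} where
  open OrderedFormulaSet Γ

  -- Exhibits l(V) as {φ₁ , … , φ_N}, strictly increasing in 𝒪_Γ; its
  -- existence says that the DLDS has exactly N distinct labels.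
  record LabelListing (D : DLDS Γ) (N : ℕ) : Set where
    open DLDS D
    field
      label   : Fin N → Carrier
      sorted  : ∀ {j k} → j <ᶠ k → label j ≼ label k × label j ≢ label k
      image   : ∀ γ → (∃[ v ] l v ≡ γ) ⇔ (∃[ j ] label j ≡ γ)

    φ : Fin N → Formula
    φ j = formula (label j)

-- The label ℓ ∈ {1,…,2N+2} is represented by ℓ - 1.
Label : ℕ → Set
Label N = Fin (2 * N + 2)

-- In the first component, zero means "stop" and `suc j` means "move to column j".
Step : ℕ → Set
Step N = Fin (suc N) × Label N

Path : ℕ → ℕ → Set
Path N h = Vec (Vec (Step N) h) N

-- Least significant bit first.
binary : ∀ k → ℕ → Vec Bool k
binary zero    n = []
binary (suc k) n = (n % 2 ≡ᵇ 1) ∷ binary k ⌊ n /2⌋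

targetBits labelBits stepBits : ℕ → ℕ
targetBits N = ⌈log₂ (N + 1) ⌉
labelBits  N = ⌈log₂ (2 * N + 3) ⌉
stepBits   N = targetBits N + labelBits N

encodingLength : ℕ → ℕ → ℕ
encodingLength N h = N * (h * stepBits N)

encodeStep : ∀ N → Step N → Vec Bool (stepBits N)
encodeStep N (t , ℓ) = binary (targetBits N) (toℕ t) ++ binary (labelBits N) (suc (toℕ ℓ))

encode : ∀ {N h} → Path N h → Vec Bool (encodingLength N h)
encode {N} P = concat (map (λ path → concat (map (encodeStep N) path)) P)

DepVec : ℕ → Set
DepVec N = Vec Bool N

zeroVec : ∀ {N} → DepVec N
zeroVec = replicate _ false

oneHot : ∀ {N} → Fin N → DepVec N
oneHot j = zeroVec [ j ]≔ true

_∨ᵛ_ _∧¬ᵛ_ : ∀ {N} → DepVec N → DepVec N → DepVec N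
_∨ᵛ_  = zipWith _∨_
_∧¬ᵛ_ = zipWith (λ x y → x ∧ not y)

module _ {N : ℕ} (φ : Fin N → Formula) where

  -- The candidate rule instances at a cell (i , j), i ≥ 1.  The side
  -- conditions are irrelevant, so that instances with the same data are equal.
  data Rule (j : Fin N) : Set where
    rep   : Rule j
    intro : (α : Formula) (b : Fin N) → .(φ j ≡ α ⊃ φ b) → Rule j
    elim  : (a k : Fin N) → .(φ k ≡ φ a ⊃ φ j) → Rule j

module _ {N : ℕ} {φ : Fin N → Formula} where

  arity : ∀ {j} → Rule φ j → ℕ
  arity rep           = 1
  arity (intro α b _) = 1
  arity (elim a k _)  = 2

  premise : ∀ {j} (r : Rule φ j) → Fin (arity r) → Fin N
  premise {j} rep       _       = j
  premise (intro α b _) _       = b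
  premise (elim a k _)  zero    = a
  premise (elim a k _)  (suc _) = k

  χ : Formula → DepVec N
  χ α with any? (λ a → α ≟ φ a)
  ... | yes (a , _) = oneHot a
  ... | no  _       = zeroVec

  result : ∀ {j} (r : Rule φ j) → (Fin (arity r) → DepVec N) → DepVec N
  result rep           d = d zero
  result (intro α b _) d = d zero ∧¬ᵛ χ α
  result (elim a k _)  d = d zero ∨ᵛ d (suc zero)

  _≟ʳ_ : ∀ {j} → DecidableEquality (Rule φ j)
  rep         ≟ʳ rep           = yes refl
  rep         ≟ʳ intro _ _ _   = no λ ()
  rep         ≟ʳ elim _ _ _    = no λ ()
  intro _ _ _ ≟ʳ rep           = no λ ()
  intro α b _ ≟ʳ intro α′ b′ _ =
    map′ (λ { (refl , refl) → refl }) (λ { refl → refl , refl }) ((α ≟ α′) ×-dec (b ≟ᶠ b′))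
  intro _ _ _ ≟ʳ elim _ _ _    = no λ ()
  elim _ _ _  ≟ʳ rep           = no λ ()
  elim _ _ _  ≟ʳ intro _ _ _   = no λ ()
  elim a k _  ≟ʳ elim a′ k′ _  =
    map′ (λ { (refl , refl) → refl }) (λ { refl → refl , refl }) ((a ≟ᶠ a′) ×-dec (k ≟ᶠ k′))

  implication? : ∀ γ β → Dec (∃[ α ] γ ≡ α ⊃ β)
  implication? (atom _)  β = no λ ()
  implication? (α ⊃ β′) β = map′ (λ { refl → α , refl }) (λ { (_ , refl) → refl }) (β′ ≟ β)

  anyRule? : ∀ {j} {Q : Rule φ j → Set} → (∀ r → Dec (Q r)) → Dec (∃ Q)
  anyRule? {j} {Q} Q? =
    map′ from to (Q? rep ⊎-dec (any? intro? ⊎-dec any? λ a → any? (elim? a)))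
    where
    Intro : Fin N → Set
    Intro b = ∃[ α ] Σ (φ j ≡ α ⊃ φ b) λ e → Q (intro α b e)

    Elim : Fin N → Fin N → Set
    Elim a k = Σ (φ k ≡ φ a ⊃ φ j) λ e → Q (elim a k e)

    intro? : ∀ b → Dec (Intro b)
    intro? b with implication? (φ j) (φ b)
    ... | no ¬p       = no λ (α , e , _) → ¬p (α , e)
    ... | yes (α , e) = map′ (λ q → α , e , q) back (Q? (intro α b e))
      where
      transport : ∀ {α′} .{e′ : φ j ≡ α′ ⊃ φ b} → α′ ≡ α → Q (intro α′ b e′) → Q (intro α b e)
      transport refl q = q

      back : Intro b → Q (intro α b e)
      back (_ , e′ , q) = transport (proj₁ (⊃-injective (trans (sym e′) e))) q

    elim? : ∀ a k → Dec (Elim a k)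
    elim? a k with φ k ≟ (φ a ⊃ φ j)
    ... | no ¬e = no λ (e , _) → ¬e e
    ... | yes e = map′ (e ,_) (λ (_ , q) → q) (Q? (elim a k e))

    from : Q rep ⊎ (∃ Intro ⊎ ∃ λ a → ∃ (Elim a)) → ∃ Q
    from (inj₁ q)                          = rep , q
    from (inj₂ (inj₁ (b , α , e , q)))     = intro α b e , q
    from (inj₂ (inj₂ (a , k , e , q)))     = elim a k e , q

    to : ∃ Q → Q rep ⊎ (∃ Intro ⊎ ∃ λ a → ∃ (Elim a))
    to (rep , q)         = inj₁ q
    to (intro α b e , q) = inj₂ (inj₁ (b , α , recompute (φ j ≟ (α ⊃ φ b)) e , q))
    to (elim a k e , q)  = inj₂ (inj₂ (a , k , recompute (φ k ≟ (φ a ⊃ φ j)) e , q))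

  allRule? : ∀ {j} {Q : Rule φ j → Set} → (∀ r → Dec (Q r)) → Dec (∀ r → Q r)
  allRule? Q? =
    map′ (λ ¬∃ r → decidable-stable (Q? r) λ ¬q → ¬∃ (r , ¬q))
         (λ ∀Q (r , ¬q) → ¬q (∀Q r))
         (¬? (anyRule? λ r → ¬? (Q? r)))

module _ {N : ℕ} (φ : Fin N → Formula) where

  Position : Fin N → Set
  Position j = Σ (Rule φ j) λ r → Fin (arity r)

  record Naming : Set where
    field
      name     : ∀ j → Position j → Label N
      name-inj : ∀ j → Injective _≡_ _≡_ (name j)

-- The column at each level of a token starting at column s of level 0;
-- `nothing` once the token has stopped.
column : ∀ {N h} → Vec (Step N) h → Fin N → Fin (suc h) → Maybe (Fin N)
column steps                 s zero    = just s
column ((zero  , _) ∷ steps) s (suc i) = nothing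
column ((suc j , _) ∷ steps) s (suc i) = column steps j i

-- In what follows i : Fin h stands for the transition from level i to level
-- i + 1, and (i , j) for the cell in column j of level i + 1.

module _ {N h : ℕ} (P : Path N h) where

  Arrives : Fin N → Fin h → Fin N → Fin N → Label N → Set
  Arrives o i j s ℓ =
    column (lookup P o) o (inject₁ i) ≡ just s × lookup (lookup P o) i ≡ (suc j , ℓ)

  arrives? : ∀ o i j s ℓ → Dec (Arrives o i j s ℓ)
  arrives? o i j s ℓ =
    Maybe.≡-dec _≟ᶠ_ _ _ ×-dec Product.≡-dec _≟ᶠ_ _≟ᶠ_ _ _

  CellActive : Fin h → Fin N → Set
  CellActive i j = ∃[ o ] ∃[ s ] ∃[ ℓ ] Arrives o i j s ℓ

  cellActive? : ∀ i j → Dec (CellActive i j)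
  cellActive? i j = any? λ o → any? λ s → any? λ ℓ → arrives? o i j s ℓ

module _ {N : ℕ} {φ : Fin N → Formula} (ν : Naming φ) {h : ℕ} (P : Path N h) where
  open Naming ν

  Activates : ∀ j (s : Fin N) (ℓ : Label N) → Position φ j → Set
  Activates j s ℓ (r , q) = name j (r , q) ≡ ℓ × s ≡ premise r q

  activates? : ∀ j s ℓ p → Dec (Activates j s ℓ p)
  activates? j s ℓ (r , q) = (name j (r , q) ≟ᶠ ℓ) ×-dec (s ≟ᶠ premise r q)

  PositionActive : Fin h → ∀ j → Position φ j → Set
  PositionActive i j p = ∃[ o ] ∃[ s ] ∃[ ℓ ] Arrives P o i j s ℓ × Activates j s ℓ p

  RuleActive : Fin h → ∀ j → Rule φ j → Set
  RuleActive i j r = ∀ q → PositionActive i j (r , q)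

  ruleActive? : ∀ i j r → Dec (RuleActive i j r)
  ruleActive? i j r = all? λ q → any? λ o → any? λ s → any? λ ℓ →
    arrives? P o i j s ℓ ×-dec activates? j s ℓ (r , q)

  UniquelyActive : Fin h → ∀ j → Rule φ j → Set
  UniquelyActive i j r = RuleActive i j r × (∀ r′ → RuleActive i j r′ → r′ ≡ r)

  uniquelyActive? : ∀ i j r → Dec (UniquelyActive i j r)
  uniquelyActive? i j r =
    ruleActive? i j r ×-dec allRule? λ r′ → ruleActive? i j r′ →-dec (r′ ≟ʳ r)

  -- The selected inputs determine exactly one admissible rule instance.
  Determined : Fin h → Fin N → Set
  Determined i j = ∃[ r ] UniquelyActive i j r ×
    (∀ o s ℓ → Arrives P o i j s ℓ → ∃[ q ] Activates j s ℓ (r , q))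

  determined? : ∀ i j → Dec (Determined i j)
  determined? i j = anyRule? λ r → uniquelyActive? i j r ×-dec
    all? λ o → all? λ s → all? λ ℓ →
      arrives? P o i j s ℓ →-dec any? λ q → activates? j s ℓ (r , q)

  nextVec : (Fin N → DepVec N) → Fin h → Fin N → DepVec N
  nextVec d i j with anyRule? (uniquelyActive? i j)
  ... | yes (r , _) = result r (λ q → d (premise r q))
  ... | no  _       = zeroVec

  depVec : ∀ i → .(i ≤ h) → Fin N → DepVec N
  depVec zero    _   = oneHot
  depVec (suc i) i<h = nextVec (depVec i (<⇒≤ i<h)) (fromℕ< i<h)

  Invalid : Set
  Invalid = ∃[ i ] ∃[ j ] CellActive P i j × ¬ Determined i j

  WellFormed : Set
  WellFormed = ∀ i j → CellActive P i j → Determined i j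

  Discharged : Fin N → Set
  Discharged c = depVec h ≤-refl c ≡ zeroVec

  Accepts : Fin N → Set
  Accepts c = Invalid ⊎ (WellFormed × Discharged c)

  accepts? : ∀ c → Dec (Accepts c)
  accepts? c =
    (any? λ i → any? λ j → cellActive? P i j ×-dec ¬? (determined? i j))
    ⊎-dec
    ((all? λ i → all? λ j → cellActive? P i j →-dec determined? i j)
     ×-dec Vec.≡-dec Bool._≟_ (depVec h ≤-refl c) zeroVec)

acc : ∀ {N} {φ : Fin N → Formula} → Naming φ → ∀ {h} → Fin N → Path N h → Bool
acc ν c P = ⌊ accepts? ν P c ⌋

{-# OPTIONS --safe #-}
-- Every predicate involved in acceptance quantifies over polynomially many
-- tokens, columns, labels and rule instances, so a Boolean formula of polynomial
-- size expresses it in terms of the bits of P and of the dependency vectors of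
-- one level.  Substituting formulas level by level would blow up exponentially;
-- instead each of the N² dependency bits of a level is computed by gates once and
-- then shared by all formulas of the next level.
module Submission where

open import Defs
open import Data.Bool using (Bool; true; false; not; _∧_; _∨_)
open import Data.Fin using (Fin; zero; suc; toℕ; inject₁; fromℕ<; combine; remQuot; _↑ˡ_; _↑ʳ_)
  renaming (_<_ to _<ᶠ_)
open import Data.Fin.Properties using (any?; remQuot-combine; toℕ<n; toℕ-injective)
  renaming (_≟_ to _≟ᶠ_; _<?_ to _<ᶠ?_)
open import Data.List using ([]; _∷_)
open import Data.Maybe using (just)
import Data.Maybe.Properties as Maybe
open import Data.Nat
  using (ℕ; zero; suc; _+_; _*_; _^_; _≤_; _<_; z≤n; s≤s; _≡ᵇ_; _%_; ⌊_/2⌋; ⌈_/2⌉)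
open import Data.Nat.Induction using (<-wellFounded)
open import Data.Nat.Logarithm using (⌈log₂_⌉)
open import Data.Nat.Logarithm.Core using (⌈log2⌉)
open import Data.Nat.Properties
open import Data.Nat.Solver using (module +-*-Solver)
open import Data.Product using (∃-syntax; _×_; _,_; proj₁; proj₂)
open import Data.Sum using (_⊎_; inj₁; inj₂; [_,_]′)
open import Data.Unit using (⊤; tt)
open import Data.Vec using (Vec; []; _∷_; lookup; concat; map; tabulate)
open import Data.Vec.Properties
  using (∷-injective; lookup-map; lookup-concat; lookup-++ˡ; lookup-++ʳ; lookup-zipWith;
         lookup-replicate; tabulate∘lookup; tabulate-cong)
open import Function using (_∘_)
open import Induction.WellFounded using (Acc) renaming (acc to accessible)
open import Relation.Binary.PropositionalEquality
  using (_≡_; _≢_; refl; sym; trans; cong; cong₂; subst; module ≡-Reasoning)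
open import Relation.Nullary using (Dec; yes; no; ¬_; does; proof; contradiction)
open import Relation.Nullary.Decidable using (⌊_⌋; _×-dec_)
open import Relation.Nullary.Reflects
  using (Reflects; ofʸ; ofⁿ; det; ¬-reflects; _×-reflects_; _⊎-reflects_; _→-reflects_)

-- Polynomial bounds

infixl 6 _⊕_
infixl 7 _⊗_

-- Kept as syntax, so that the bounds of the combinators below are inferred by unification.
data Bound : Set where
  con     : ℕ → Bound
  X       : Bound
  _⊕_ _⊗_ : Bound → Bound → Bound

⟦_⟧ : Bound → ℕ → ℕ
⟦ con c ⟧ x = c
⟦ X ⟧     x = x
⟦ p ⊕ q ⟧ x = ⟦ p ⟧ x + ⟦ q ⟧ x
⟦ p ⊗ q ⟧ x = ⟦ p ⟧ x * ⟦ q ⟧ x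

addPoly : Polynomial → Polynomial → Polynomial
addPoly []       q        = q
addPoly (a ∷ p)  []       = a ∷ p
addPoly (a ∷ p)  (b ∷ q)  = a + b ∷ addPoly p q

scalePoly : ℕ → Polynomial → Polynomial
scalePoly c []      = []
scalePoly c (a ∷ p) = c * a ∷ scalePoly c p

mulPoly : Polynomial → Polynomial → Polynomial
mulPoly []      q = []
mulPoly (a ∷ p) q = addPoly (scalePoly a q) (0 ∷ mulPoly p q)

evalPoly-add : ∀ p q x → evalPoly (addPoly p q) x ≡ evalPoly p x + evalPoly q x
evalPoly-add []      q       x = refl
evalPoly-add (a ∷ p) []      x = sym (+-identityʳ _)
evalPoly-add (a ∷ p) (b ∷ q) x rewrite evalPoly-add p q x =
  solve 5 (λ a b x P Q → a :+ b :+ x :* (P :+ Q) := a :+ x :* P :+ (b :+ x :* Q))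
    refl a b x (evalPoly p x) (evalPoly q x)
  where open +-*-Solver

evalPoly-scale : ∀ c p x → evalPoly (scalePoly c p) x ≡ c * evalPoly p x
evalPoly-scale c []      x = sym (*-zeroʳ c)
evalPoly-scale c (a ∷ p) x rewrite evalPoly-scale c p x =
  solve 4 (λ c a x P → c :* a :+ x :* (c :* P) := c :* (a :+ x :* P))
    refl c a x (evalPoly p x)
  where open +-*-Solver

evalPoly-mul : ∀ p q x → evalPoly (mulPoly p q) x ≡ evalPoly p x * evalPoly q x
evalPoly-mul []      q x = refl
evalPoly-mul (a ∷ p) q x
  rewrite evalPoly-add (scalePoly a q) (0 ∷ mulPoly p q) x
        | evalPoly-scale a q x
        | evalPoly-mul p q x =
  solve 4 (λ a x P Q → a :* Q :+ x :* (P :* Q) := (a :+ x :* P) :* Q)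
    refl a x (evalPoly p x) (evalPoly q x)
  where open +-*-Solver

toPoly : Bound → Polynomial
toPoly (con c) = c ∷ []
toPoly X       = 0 ∷ 1 ∷ []
toPoly (p ⊕ q) = addPoly (toPoly p) (toPoly q)
toPoly (p ⊗ q) = mulPoly (toPoly p) (toPoly q)

evalPoly-toPoly : ∀ p x → evalPoly (toPoly p) x ≡ ⟦ p ⟧ x
evalPoly-toPoly (con c) x = solve 2 (λ c x → c :+ x :* con 0 := c) refl c x
  where open +-*-Solver
evalPoly-toPoly X       x = solve 1 (λ x → x :* (con 1 :+ x :* con 0) := x) refl x
  where open +-*-Solver
evalPoly-toPoly (p ⊕ q) x =
  trans (evalPoly-add (toPoly p) (toPoly q) x)
        (cong₂ _+_ (evalPoly-toPoly p x) (evalPoly-toPoly q x))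
evalPoly-toPoly (p ⊗ q) x =
  trans (evalPoly-mul (toPoly p) (toPoly q) x)
        (cong₂ _*_ (evalPoly-toPoly p x) (evalPoly-toPoly q x))

-- Formulas and their compilation to gates

data Expr (V : Set) : Set where
  var       : V → Expr V
  const     : Bool → Expr V
  ¬ᵉ_       : Expr V → Expr V
  _∧ᵉ_ _∨ᵉ_ : Expr V → Expr V → Expr V

-- Leaves count zero because a variable or constant becomes a `Source`, which needs no gate.
∣_∣ᵉ : ∀ {V} → Expr V → ℕ
∣ var x ∣ᵉ   = 0
∣ const b ∣ᵉ = 0
∣ ¬ᵉ e ∣ᵉ    = suc ∣ e ∣ᵉ
∣ e ∧ᵉ f ∣ᵉ  = suc (∣ e ∣ᵉ + ∣ f ∣ᵉ)
∣ e ∨ᵉ f ∣ᵉ  = suc (∣ e ∣ᵉ + ∣ f ∣ᵉ)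

eval : ∀ {V} → Expr V → (V → Bool) → Bool
eval (var x)   ρ = ρ x
eval (const b) ρ = b
eval (¬ᵉ e)    ρ = not (eval e ρ)
eval (e ∧ᵉ f)  ρ = eval e ρ ∧ eval f ρ
eval (e ∨ᵉ f)  ρ = eval e ρ ∨ eval f ρ

-- Since `gate zero` denotes the newest gate, each added gate shifts the indices of all older ones.
-- A proof of `gs ⊑ gs′` records how many were added, and `lift` performs the shift.
data _⊑_ {n g} (gs : Gates n g) : ∀ {g′} → Gates n g′ → Set where
  ⊑-refl : gs ⊑ gs
  ⊑-step : ∀ {g′} {gs′ : Gates n g′} {γ} → gs ⊑ gs′ → gs ⊑ (gs′ ▷ γ)

⊑-trans : ∀ {n g g′ g″} {gs : Gates n g} {gs′ : Gates n g′} {gs″ : Gates n g″} →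
          gs ⊑ gs′ → gs′ ⊑ gs″ → gs ⊑ gs″
⊑-trans p ⊑-refl     = p
⊑-trans p (⊑-step q) = ⊑-step (⊑-trans p q)

weaken : ∀ {n g} → Source n g → Source n (suc g)
weaken (input i)    = input i
weaken (gate k)     = gate (suc k)
weaken (constant b) = constant b

weaken-eval : ∀ {n g} xs v (vs : Vec Bool g) (s : Source n g) →
              evalSource xs (v ∷ vs) (weaken s) ≡ evalSource xs vs s
weaken-eval xs v vs (input i)    = refl
weaken-eval xs v vs (gate k)     = refl
weaken-eval xs v vs (constant b) = refl

lift : ∀ {n g g′} {gs : Gates n g} {gs′ : Gates n g′} → gs ⊑ gs′ → Source n g → Source n g′
lift ⊑-refl     s = s
lift (⊑-step p) s = weaken (lift p s)

lift-eval : ∀ {n g g′} {gs : Gates n g} {gs′ : Gates n g′} (p : gs ⊑ gs′) xs s →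
            evalSource xs (evalGates gs′ xs) (lift p s) ≡ evalSource xs (evalGates gs xs) s
lift-eval ⊑-refl     xs s = refl
lift-eval (⊑-step p) xs s = trans (weaken-eval xs _ _ (lift p s)) (lift-eval p xs s)

module Compilation {n} {A : Set} (enc : A → Vec Bool n) where

  -- Correctness is demanded only on encodings `enc a`; on other bit strings the value is free.
  Computes : ∀ {g} → Gates n g → Source n g → (A → Bool) → Set
  Computes gs s f = ∀ a → evalSource (enc a) (evalGates gs (enc a)) s ≡ f a

  -- A whole family of outputs, indexed by `I`, is read off one gate list, so all of them are
  -- available to whatever is built on top. The bound `k` counts only the added gates.
  record Extension {g} (gs : Gates n g) (k : ℕ) {I : Set} (F : I → A → Bool) : Set where
    field
      {total}  : ℕ
      gates⁺   : Gates n total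
      extends  : gs ⊑ gates⁺
      bounded  : total ≤ k + g
      source   : I → Source n total
      computes : ∀ i → Computes gates⁺ (source i) (F i)

  open Extension public

  lift-computes : ∀ {g g′} {gs : Gates n g} {gs′ : Gates n g′} (p : gs ⊑ gs′) {s f} →
                  Computes gs s f → Computes gs′ (lift p s) f
  lift-computes p {s} c a = trans (lift-eval p (enc a) s) (c a)

  bounded-trans : ∀ {g g₁ g₂} k l → g₁ ≤ k + g → g₂ ≤ l + g₁ → g₂ ≤ k + l + g
  bounded-trans {g} {g₁} {g₂} k l p q = begin
    g₂          ≤⟨ q ⟩
    l + g₁      ≤⟨ +-monoʳ-≤ l p ⟩
    l + (k + g) ≡⟨ +-assoc l k g ⟨
    l + k + g   ≡⟨ cong (_+ g) (+-comm l k) ⟩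
    k + l + g   ∎
    where open ≤-Reasoning

  -- The new cost `l` comes first so that adding one level to a cost `i * levelSize` gives
  -- `suc i * levelSize` by definition.
  _⨾_ : ∀ {g k l I J} {gs : Gates n g} {F : I → A → Bool} {G : J → A → Bool}
        (E : Extension gs k F) → Extension (gates⁺ E) l G → Extension gs (l + k) G
  _⨾_ {g} {k} {l} E E′ = record
    { gates⁺ = gates⁺ E′ ; extends = ⊑-trans (extends E) (extends E′)
    ; bounded = subst (λ m → total E′ ≤ m + g) (+-comm k l) (bounded-trans k l (bounded E) (bounded E′))
    ; source = source E′ ; computes = computes E′ }

  module _ {V : Set} {ρ : A → V → Bool} where

    Sources : ∀ {g} → Gates n g → Set
    Sources {g} gs = ∀ x → ∃[ s ] Computes gs s (λ a → ρ a x)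

    lift-sources : ∀ {g g′} {gs : Gates n g} {gs′ : Gates n g′} → gs ⊑ gs′ → Sources gs → Sources gs′
    lift-sources p S x = lift p (proj₁ (S x)) , lift-computes p (proj₂ (S x))

    -- A second operand is compiled on top of the gates of the first, whose output is then lifted.
    -- Variables cost nothing however complex the gates behind their sources are.
    compile : ∀ {g} (gs : Gates n g) → Sources gs → (e : Expr V) →
              Extension gs ∣ e ∣ᵉ {⊤} (λ _ a → eval e (ρ a))
    compile gs S (var x) = record
      { gates⁺ = gs ; extends = ⊑-refl ; bounded = ≤-refl
      ; source = λ _ → proj₁ (S x) ; computes = λ _ → proj₂ (S x) }
    compile gs S (const b) = record
      { gates⁺ = gs ; extends = ⊑-refl ; bounded = ≤-refl
      ; source = λ _ → constant b ; computes = λ _ _ → refl }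
    compile gs S (¬ᵉ e) = record
      { gates⁺ = gates⁺ E ▷ NOT (source E tt) ; extends = ⊑-step (extends E)
      ; bounded = s≤s (bounded E)
      ; source = λ _ → gate zero ; computes = λ _ a → cong not (computes E tt a) }
      where E = compile gs S e
    compile gs S (e ∧ᵉ f) = record
      { gates⁺ = gates⁺ F ▷ AND (lift (extends F) (source E tt)) (source F tt)
      ; extends = ⊑-step (⊑-trans (extends E) (extends F))
      ; bounded = s≤s (bounded-trans ∣ e ∣ᵉ ∣ f ∣ᵉ (bounded E) (bounded F))
      ; source = λ _ → gate zero
      ; computes = λ _ a → cong₂ _∧_ (lift-computes (extends F) (computes E tt) a) (computes F tt a) }
      where
      E = compile gs S e
      F = compile (gates⁺ E) (lift-sources (extends E) S) f
    compile gs S (e ∨ᵉ f) = record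
      { gates⁺ = gates⁺ F ▷ OR (lift (extends F) (source E tt)) (source F tt)
      ; extends = ⊑-step (⊑-trans (extends E) (extends F))
      ; bounded = s≤s (bounded-trans ∣ e ∣ᵉ ∣ f ∣ᵉ (bounded E) (bounded F))
      ; source = λ _ → gate zero
      ; computes = λ _ a → cong₂ _∨_ (lift-computes (extends F) (computes E tt) a) (computes F tt a) }
      where
      E = compile gs S e
      F = compile (gates⁺ E) (lift-sources (extends E) S) f

    -- The formulas are stacked on one another, but each reads the original sources, lifted; hence
    -- the costs add up.
    compileAll : ∀ {g} (gs : Gates n g) → Sources gs → ∀ {m} k (es : Fin m → Expr V) →
                 (∀ i → ∣ es i ∣ᵉ ≤ k) → Extension gs (m * k) (λ i a → eval (es i) (ρ a))
    compileAll gs S {zero} k es es≤k = record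
      { gates⁺ = gs ; extends = ⊑-refl ; bounded = ≤-refl ; source = λ () ; computes = λ () }
    compileAll gs S {suc m} k es es≤k = record
      { gates⁺ = gates⁺ F ; extends = ⊑-trans (extends E) (extends F)
      ; bounded = bounded-trans k (m * k)
          (≤-trans (bounded E) (+-monoˡ-≤ _ (es≤k zero))) (bounded F)
      ; source   = λ { zero → lift (extends F) (source E tt) ; (suc i) → source F i }
      ; computes = λ { zero → lift-computes (extends F) (computes E tt) ; (suc i) → computes F i } }
      where
      E = compile gs S (es zero)
      F = compileAll (gates⁺ E) (lift-sources (extends E) S) k (es ∘ suc) (es≤k ∘ suc)

-- Predicates expressed by formulas of bounded size

Reflects-map : ∀ {A B : Set} {b} → (A → B) → (B → A) → Reflects A b → Reflects B b
Reflects-map f g (ofʸ a)  = ofʸ (f a)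
Reflects-map f g (ofⁿ ¬a) = ofⁿ (¬a ∘ g)

≡true-reflects : ∀ b → Reflects (b ≡ true) b
≡true-reflects true  = ofʸ refl
≡true-reflects false = ofⁿ λ ()

⌊⌋-reflects : ∀ {A : Set} (d : Dec A) → Reflects A ⌊ d ⌋
⌊⌋-reflects (yes a) = ofʸ a
⌊⌋-reflects (no ¬a) = ofⁿ ¬a

lookup-ext : ∀ {A : Set} {m} {v w : Vec A m} → (∀ k → lookup v k ≡ lookup w k) → v ≡ w
lookup-ext {v = v} {w} e = begin
  v                   ≡⟨ tabulate∘lookup v ⟨
  tabulate (lookup v) ≡⟨ tabulate-cong e ⟩
  tabulate (lookup w) ≡⟨ tabulate∘lookup w ⟩
  w                   ∎
  where open ≡-Reasoning

module Expressibility {A V : Set} (ρ : A → V → Bool) (N : ℕ) where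

  -- One formula must serve all `a`. The bound is evaluated at `N` alone, so it is uniform in the
  -- formulas and the naming. Using `Reflects` makes the result independent of any particular
  -- decision procedure for `Q`.
  record Expressible (p : Bound) (Q : A → Set) : Set where
    field
      expr     : Expr V
      small    : ∣ expr ∣ᵉ ≤ ⟦ p ⟧ N
      reflects : ∀ a → Reflects (Q a) (eval expr (ρ a))

  open Expressible public

  private variable
    p q : Bound
    Q R : A → Set

  mapᵉ : (∀ {a} → Q a → R a) → (∀ {a} → R a → Q a) → Expressible p Q → Expressible p R
  mapᵉ f g E = record
    { expr = expr E ; small = small E ; reflects = λ a → Reflects-map f g (reflects E a) }

  -- A statement independent of the input is decided while the formula is being built and enters it
  -- as a constant.
  fixed : ∀ {B : Set} → Dec B → Expressible p (λ _ → B)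
  fixed d = record { expr = const (does d) ; small = z≤n ; reflects = λ _ → proof d }

  infixr 7 _×ᵉ_
  infixr 6 _⊎ᵉ_
  infixr 5 _→ᵉ_

  notᵉ : Expressible p Q → Expressible (con 1 ⊕ p) (λ a → ¬ Q a)
  notᵉ E = record
    { expr = ¬ᵉ expr E ; small = s≤s (small E) ; reflects = λ a → ¬-reflects (reflects E a) }

  _×ᵉ_ : Expressible p Q → Expressible q R → Expressible (con 1 ⊕ (p ⊕ q)) (λ a → Q a × R a)
  E ×ᵉ F = record
    { expr = expr E ∧ᵉ expr F ; small = s≤s (+-mono-≤ (small E) (small F))
    ; reflects = λ a → reflects E a ×-reflects reflects F a }

  _⊎ᵉ_ : Expressible p Q → Expressible q R → Expressible (con 1 ⊕ (p ⊕ q)) (λ a → Q a ⊎ R a)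
  E ⊎ᵉ F = record
    { expr = expr E ∨ᵉ expr F ; small = s≤s (+-mono-≤ (small E) (small F))
    ; reflects = λ a → reflects E a ⊎-reflects reflects F a }

  _→ᵉ_ : Expressible p Q → Expressible q R → Expressible (con 2 ⊕ (p ⊕ q)) (λ a → Q a → R a)
  E →ᵉ F = record
    { expr = (¬ᵉ expr E) ∨ᵉ expr F ; small = s≤s (s≤s (+-mono-≤ (small E) (small F)))
    ; reflects = λ a → reflects E a →-reflects reflects F a }

  -- Each disjunct costs one OR gate beyond its own size, the last being joined to `false`. The
  -- range is bounded by `q` because `m` may be `h` or an arity, which are not functions of `N`.
  anyᵉ : ∀ {m} {Q : Fin m → A → Set} → m ≤ ⟦ q ⟧ N → (∀ i → Expressible p (Q i)) →
         Expressible (q ⊗ (con 1 ⊕ p)) (λ a → ∃[ i ] Q i a)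
  anyᵉ {q} {p} m≤q Es = record
    { expr = disj Es ; small = ≤-trans (disj-size Es) (*-monoˡ-≤ (suc (⟦ p ⟧ N)) m≤q)
    ; reflects = λ a → disj-reflects a Es }
    where
    disj : ∀ {m} {Q : Fin m → A → Set} → (∀ i → Expressible p (Q i)) → Expr V
    disj {zero}  Es = const false
    disj {suc m} Es = expr (Es zero) ∨ᵉ disj (Es ∘ suc)

    disj-size : ∀ {m} {Q : Fin m → A → Set} (Es : ∀ i → Expressible p (Q i)) →
                ∣ disj Es ∣ᵉ ≤ m * suc (⟦ p ⟧ N)
    disj-size {zero}  Es = z≤n
    disj-size {suc m} Es = s≤s (+-mono-≤ (small (Es zero)) (disj-size (Es ∘ suc)))

    disj-reflects : ∀ a {m} {Q : Fin m → A → Set} (Es : ∀ i → Expressible p (Q i)) →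
                    Reflects (∃[ i ] Q i a) (eval (disj Es) (ρ a))
    disj-reflects a {zero}  Es = ofⁿ λ ()
    disj-reflects a {suc m} Es =
      Reflects-map [ zero ,_ , (λ (i , x) → suc i , x) ]′
                   (λ { (zero , x) → inj₁ x ; (suc i , x) → inj₂ (i , x) })
                   (reflects (Es zero) a ⊎-reflects disj-reflects a (Es ∘ suc))

  allᵉ : ∀ {m} {Q : Fin m → A → Set} → m ≤ ⟦ q ⟧ N → (∀ i → Expressible p (Q i)) →
         Expressible (q ⊗ (con 1 ⊕ p)) (λ a → ∀ i → Q i a)
  allᵉ {q} {p} m≤q Es = record
    { expr = conj Es ; small = ≤-trans (conj-size Es) (*-monoˡ-≤ (suc (⟦ p ⟧ N)) m≤q)
    ; reflects = λ a → conj-reflects a Es }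
    where
    conj : ∀ {m} {Q : Fin m → A → Set} → (∀ i → Expressible p (Q i)) → Expr V
    conj {zero}  Es = const true
    conj {suc m} Es = expr (Es zero) ∧ᵉ conj (Es ∘ suc)

    conj-size : ∀ {m} {Q : Fin m → A → Set} (Es : ∀ i → Expressible p (Q i)) →
                ∣ conj Es ∣ᵉ ≤ m * suc (⟦ p ⟧ N)
    conj-size {zero}  Es = z≤n
    conj-size {suc m} Es = s≤s (+-mono-≤ (small (Es zero)) (conj-size (Es ∘ suc)))

    conj-reflects : ∀ a {m} {Q : Fin m → A → Set} (Es : ∀ i → Expressible p (Q i)) →
                    Reflects (∀ i → Q i a) (eval (conj Es) (ρ a))
    conj-reflects a {zero}  Es = ofʸ λ ()
    conj-reflects a {suc m} Es =
      Reflects-map (λ { (x , xs) zero → x ; (x , xs) (suc i) → xs i })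
                   (λ xs → xs zero , xs ∘ suc)
                   (reflects (Es zero) a ×-reflects conj-reflects a (Es ∘ suc))

  bitIs : ∀ {f : A → Bool} x → (∀ a → ρ a x ≡ f a) → ∀ b → Expressible (con 1) (λ a → f a ≡ b)
  bitIs x e true = record
    { expr = var x ; small = z≤n
    ; reflects = λ a → subst (λ b → Reflects (b ≡ true) (ρ a x)) (e a) (≡true-reflects _) }
  bitIs x e false = record
    { expr = ¬ᵉ var x ; small = ≤-refl
    ; reflects = λ a → subst (λ b → Reflects (b ≡ false) (not (ρ a x))) (e a) (≡false-reflects _) }
    where
    ≡false-reflects : ∀ b → Reflects (b ≡ false) (not b)
    ≡false-reflects true  = ofⁿ λ ()
    ≡false-reflects false = ofʸ refl

  wordIs : ∀ {m} {w : A → Vec Bool m} (x : Fin m → V) → (∀ k a → ρ a (x k) ≡ lookup (w a) k) →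
           m ≤ ⟦ q ⟧ N → ∀ v → Expressible (q ⊗ (con 1 ⊕ con 1)) (λ a → w a ≡ v)
  wordIs x e m≤q v = mapᵉ lookup-ext (λ { refl _ → refl })
    (allᵉ m≤q λ k → bitIs (x k) (e k) (lookup v k))

-- Binary encoding

n≤⌈n/2⌉+⌈n/2⌉ : ∀ n → n ≤ ⌈ n /2⌉ + ⌈ n /2⌉
n≤⌈n/2⌉+⌈n/2⌉ n = subst (_≤ ⌈ n /2⌉ + ⌈ n /2⌉) (⌊n/2⌋+⌈n/2⌉≡n n) (+-monoˡ-≤ _ (⌊n/2⌋≤⌈n/2⌉ n))

-- This makes the words of the encoding long enough to determine the encoded numbers. The induction
-- follows the recursion of `⌈log2⌉`, from `suc (suc n)` to `suc ⌈ n /2⌉`, for an arbitrary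
-- accessibility proof so that the hypothesis concerns exactly the recursive call.
n≤2^⌈log₂n⌉ : ∀ n → n ≤ 2 ^ ⌈log₂ n ⌉
n≤2^⌈log₂n⌉ n = go n (<-wellFounded n)
  where
  go : ∀ n (a : Acc _<_ n) → n ≤ 2 ^ ⌈log2⌉ n a
  go 0 _ = z≤n
  go 1 _ = ≤-refl
  go (suc (suc n)) (accessible rs) = begin
    suc (suc n)                              ≤⟨ s≤s (s≤s (n≤⌈n/2⌉+⌈n/2⌉ n)) ⟩
    suc (suc (⌈ n /2⌉ + ⌈ n /2⌉))            ≡⟨ cong suc (+-suc _ _) ⟨
    suc ⌈ n /2⌉ + suc ⌈ n /2⌉                ≤⟨ +-mono-≤ ih ih ⟩
    2 ^ l + 2 ^ l                            ≡⟨ cong (2 ^ l +_) (+-identityʳ (2 ^ l)) ⟨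
    2 ^ suc l                                ∎
    where
    open ≤-Reasoning
    l  = ⌈log2⌉ (suc ⌈ n /2⌉) (rs (⌈n/2⌉<n n))
    ih = go (suc ⌈ n /2⌉) (rs (⌈n/2⌉<n n))

-- Crude, but it keeps word lengths within a polynomial bound.
⌈log₂n⌉≤n : ∀ n → ⌈log₂ n ⌉ ≤ n
⌈log₂n⌉≤n n = go n (<-wellFounded n)
  where
  go : ∀ n (a : Acc _<_ n) → ⌈log2⌉ n a ≤ n
  go 0 _ = z≤n
  go 1 _ = z≤n
  go (suc (suc n)) (accessible rs) =
    s≤s (≤-trans (go (suc ⌈ n /2⌉) (rs (⌈n/2⌉<n n))) (s≤s (⌈n/2⌉≤n n)))

parity-half-injective : ∀ m n → (m % 2 ≡ᵇ 1) ≡ (n % 2 ≡ᵇ 1) → ⌊ m /2⌋ ≡ ⌊ n /2⌋ → m ≡ n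
parity-half-injective 0             0             p e = refl
parity-half-injective 1             1             p e = refl
parity-half-injective (suc (suc m)) (suc (suc n)) p e =
  cong (2 +_) (parity-half-injective m n p (suc-injective e))
parity-half-injective 0 1 () e
parity-half-injective 1 0 () e

half-< : ∀ {m n} → m < 2 * n → ⌊ m /2⌋ < n
half-< {m} {n} m<2n = begin
  -- By definition `⌈ x /2⌉` is `⌊ suc x /2⌋`, and halving `suc (suc m)` gives `suc ⌊ m /2⌋`.
  suc ⌊ m /2⌋       ≤⟨ ⌊n/2⌋-mono (s≤s m<2n) ⟩
  ⌈ n + (n + 0) /2⌉ ≡⟨ cong (λ x → ⌈ n + x /2⌉) (+-identityʳ n) ⟩
  ⌈ n + n /2⌉       ≡⟨ n≡⌈n+n/2⌉ n ⟨
  n                 ∎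
  where open ≤-Reasoning

binary-injective : ∀ k {m n} → m < 2 ^ k → n < 2 ^ k → binary k m ≡ binary k n → m ≡ n
binary-injective zero    (s≤s z≤n) (s≤s z≤n) e = refl
binary-injective (suc k) {m} {n} m< n< e with ∷-injective e
... | p , es = parity-half-injective m n p (binary-injective k (half-< m<) (half-< n<) es)

-- Predicates on paths

-- A step names its target column outright, so after a transition the position of a token depends
-- only on that step and on its not having stopped earlier. With the converse below, this replaces
-- the recursion of `column` by a flat condition on the bits of one path; the starting column
-- matters at level 0 only.
column-suc⇒ : ∀ {N h} (steps : Vec (Step N) h) {s₀ s} i → column steps s₀ (suc i) ≡ just s →
              proj₁ (lookup steps i) ≡ suc s × (∀ k → k <ᶠ i → proj₁ (lookup steps k) ≢ zero)
column-suc⇒ ((suc j , _) ∷ steps) zero    refl = refl , λ _ ()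
column-suc⇒ ((suc j , _) ∷ steps) (suc i) e with column-suc⇒ steps i e
... | t , nz = t , λ { zero _ () ; (suc k) (s≤s k<i) → nz k k<i }

column-suc⇐ : ∀ {N h} (steps : Vec (Step N) h) {s₀ s} i →
              proj₁ (lookup steps i) ≡ suc s × (∀ k → k <ᶠ i → proj₁ (lookup steps k) ≢ zero) →
              column steps s₀ (suc i) ≡ just s
column-suc⇐ ((zero  , _) ∷ steps) (suc i) (_ , nz)    = contradiction refl (nz zero (s≤s z≤n))
column-suc⇐ ((suc j , _) ∷ steps) zero    (refl , _)  = refl
column-suc⇐ ((suc j , _) ∷ steps) (suc i) (t , nz)    =
  column-suc⇐ steps i (t , λ k k<i → nz (suc k) (s≤s k<i))

stepBit : ∀ {N h} → Fin N → Fin h → Fin (stepBits N) → Fin (encodingLength N h)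
stepBit o i k = combine o (combine i k)

lookup-encode : ∀ {N h} (P : Path N h) o i k →
                lookup (encode P) (stepBit o i k) ≡ lookup (encodeStep N (lookup (lookup P o) i)) k
lookup-encode {N} P o i k = begin
  lookup (encode P) (stepBit o i k)
    ≡⟨ lookup-concat (map (λ path → concat (map (encodeStep N) path)) P) o (combine i k) ⟩
  lookup (lookup (map (λ path → concat (map (encodeStep N) path)) P) o) (combine i k)
    ≡⟨ cong (λ v → lookup v (combine i k)) (lookup-map o _ P) ⟩
  lookup (concat (map (encodeStep N) (lookup P o))) (combine i k)
    ≡⟨ lookup-concat (map (encodeStep N) (lookup P o)) i k ⟩
  lookup (lookup (map (encodeStep N) (lookup P o)) i) k
    ≡⟨ cong (λ v → lookup v k) (lookup-map i (encodeStep N) (lookup P o)) ⟩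
  lookup (encodeStep N (lookup (lookup P o) i)) k ∎
  where open ≡-Reasoning

-- These mirror, constructor by constructor, the bounds that the combinators produce. `X` bounds
-- ranges over columns, tokens and transitions, `labelsᵇ` those over labels and rule instances;
-- `con 0` stands for a `fixed` part.
targetᵇ labelᵇ stepᵇ columnᵇ arrivesᵇ labelsᵇ : Bound
cellActiveᵇ ruleActiveᵇ uniqueᵇ determinedᵇ nextᵇ acceptsᵇ : Bound
targetᵇ     = (X ⊕ con 1) ⊗ (con 1 ⊕ con 1)
labelᵇ      = (con 2 ⊗ X ⊕ con 3) ⊗ (con 1 ⊕ con 1)
stepᵇ       = con 1 ⊕ (targetᵇ ⊕ labelᵇ)
columnᵇ     = con 1 ⊕ (targetᵇ ⊕ X ⊗ (con 1 ⊕ (con 2 ⊕ (con 0 ⊕ (con 1 ⊕ targetᵇ)))))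
arrivesᵇ    = con 1 ⊕ (columnᵇ ⊕ stepᵇ)
labelsᵇ     = con 2 ⊗ X ⊕ con 2
cellActiveᵇ = X ⊗ (con 1 ⊕ X ⊗ (con 1 ⊕ labelsᵇ ⊗ (con 1 ⊕ arrivesᵇ)))
ruleActiveᵇ =
  con 2 ⊗ (con 1 ⊕ X ⊗ (con 1 ⊕ X ⊗ (con 1 ⊕ labelsᵇ ⊗ (con 1 ⊕ (con 1 ⊕ (arrivesᵇ ⊕ con 0))))))
uniqueᵇ     = con 1 ⊕ (ruleActiveᵇ ⊕ labelsᵇ ⊗ (con 1 ⊕ (con 2 ⊕ (ruleActiveᵇ ⊕ con 0))))
determinedᵇ = labelsᵇ ⊗ (con 1 ⊕ (con 1 ⊕ (uniqueᵇ ⊕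
  X ⊗ (con 1 ⊕ X ⊗ (con 1 ⊕ labelsᵇ ⊗ (con 1 ⊕ (con 2 ⊕ (arrivesᵇ ⊕ con 0))))))))
nextᵇ       = labelsᵇ ⊗ (con 1 ⊕ (con 1 ⊕ (uniqueᵇ ⊕ con 1)))
acceptsᵇ    = con 1 ⊕
  ( X ⊗ (con 1 ⊕ X ⊗ (con 1 ⊕ (con 1 ⊕ (cellActiveᵇ ⊕ (con 1 ⊕ determinedᵇ)))))
  ⊕ (con 1 ⊕ ( X ⊗ (con 1 ⊕ X ⊗ (con 1 ⊕ (con 2 ⊕ (cellActiveᵇ ⊕ determinedᵇ))))
             ⊕ X ⊗ (con 1 ⊕ con 1))))

module PathPredicates
  {N h : ℕ} (h≤N : h ≤ N) {φ : Fin N → Formula} (ν : Naming φ) (d : Path N h → Fin N → DepVec N)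
  where

  open Naming ν

  -- The dependency bits of the level at hand are variables on a par with the input bits. With `d`
  -- left abstract, the formulas for the next level have a size that does not depend on the depth.
  Var : Set
  Var = Fin (encodingLength N h) ⊎ (Fin N × Fin N)

  env : Path N h → Var → Bool
  env P (inj₁ k)       = lookup (encode P) k
  env P (inj₂ (j , k)) = lookup (d P j) k

  open Expressibility env N

  stepAt : Fin N → Fin h → Path N h → Step N
  stepAt o i P = lookup (lookup P o) i

  targetIs : ∀ o i t → Expressible targetᵇ (λ P → proj₁ (stepAt o i P) ≡ t)
  targetIs o i t =
    mapᵉ (λ e → toℕ-injective (binary-injective (targetBits N) (in-range _) (in-range _) e))
        (cong (binary (targetBits N) ∘ toℕ))
        (wordIs (λ k → inj₁ (stepBit o i (k ↑ˡ labelBits N)))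
                (λ k P → trans (lookup-encode P o i _) (lookup-++ˡ (binary (targetBits N) _) _ k))
                (⌈log₂n⌉≤n (N + 1))
                (binary (targetBits N) (toℕ t)))
    where
    in-range : (t : Fin (suc N)) → toℕ t < 2 ^ targetBits N
    in-range t = begin-strict
      toℕ t            <⟨ toℕ<n t ⟩
      suc N            ≡⟨ +-comm N 1 ⟨
      N + 1            ≤⟨ n≤2^⌈log₂n⌉ (N + 1) ⟩
      2 ^ targetBits N ∎
      where open ≤-Reasoning

  labelIs : ∀ o i ℓ → Expressible labelᵇ (λ P → proj₂ (stepAt o i P) ≡ ℓ)
  labelIs o i ℓ =
    -- The encoding writes labels counted from 1, hence the extra `suc`.
    mapᵉ (λ e → toℕ-injective (suc-injective
                 (binary-injective (labelBits N) (in-range _) (in-range _) e)))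
        (cong (binary (labelBits N) ∘ suc ∘ toℕ))
        (wordIs (λ k → inj₁ (stepBit o i (targetBits N ↑ʳ k)))
                (λ k P → trans (lookup-encode P o i _) (lookup-++ʳ (binary (targetBits N) _) _ k))
                (⌈log₂n⌉≤n (2 * N + 3))
                (binary (labelBits N) (suc (toℕ ℓ))))
    where
    in-range : (ℓ : Label N) → suc (toℕ ℓ) < 2 ^ labelBits N
    in-range ℓ = begin-strict
      suc (toℕ ℓ)       <⟨ s≤s (toℕ<n ℓ) ⟩
      suc (2 * N + 2)   ≡⟨ +-suc (2 * N) 2 ⟨
      2 * N + 3         ≤⟨ n≤2^⌈log₂n⌉ (2 * N + 3) ⟩
      2 ^ labelBits N   ∎
      where open ≤-Reasoning

  stepIs : ∀ o i t ℓ → Expressible stepᵇ (λ P → stepAt o i P ≡ (t , ℓ))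
  stepIs o i t ℓ =
    mapᵉ (λ (e , f) → cong₂ _,_ e f) (λ e → cong proj₁ e , cong proj₂ e)
         (targetIs o i t ×ᵉ labelIs o i ℓ)

  columnIs : ∀ o i s → Expressible columnᵇ (λ P → column (lookup P o) o (inject₁ i) ≡ just s)
  columnIs o zero    s = fixed (Maybe.≡-dec _≟ᶠ_ (just o) (just s))
  columnIs o (suc i) s =
    -- Level `suc i` is entered by transition `inject₁ i`. The guard comparing `k` with it is a
    -- constant, so only stops at earlier transitions are really tested.
    mapᵉ (λ {P} → column-suc⇐ (lookup P o) (inject₁ i))
         (λ {P} → column-suc⇒ (lookup P o) (inject₁ i))
        (targetIs o (inject₁ i) (suc s) ×ᵉ
         allᵉ h≤N λ k → fixed (k <ᶠ? inject₁ i) →ᵉ notᵉ (targetIs o k zero))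

  arrives : ∀ o i j s ℓ → Expressible arrivesᵇ (λ P → Arrives P o i j s ℓ)
  arrives o i j s ℓ = columnIs o i s ×ᵉ stepIs o i (suc j) ℓ

  cellActive : ∀ i j → Expressible cellActiveᵇ (λ P → CellActive P i j)
  cellActive i j = anyᵉ ≤-refl λ o → anyᵉ ≤-refl λ s → anyᵉ ≤-refl λ ℓ → arrives o i j s ℓ

  -- Rule instances are enumerated by the labels of their first premises, so that
  -- there are at most 2N + 2 of them.
  firstPremise : ∀ {j} (r : Rule φ j) → Fin (arity r)
  firstPremise rep           = zero
  firstPremise (intro _ _ _) = zero
  firstPremise (elim _ _ _)  = zero

  ruleName : ∀ {j} → Rule φ j → Label N
  ruleName {j} r = name j (r , firstPremise r)

  ruleName-inj : ∀ {j} {r r′ : Rule φ j} → ruleName r ≡ ruleName r′ → r ≡ r′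
  ruleName-inj {j} e = cong proj₁ (name-inj j e)

  anyRuleᵉ : ∀ {p j} {Q : Rule φ j → Path N h → Set} → (∀ r → Expressible p (Q r)) →
             Expressible (labelsᵇ ⊗ (con 1 ⊕ p)) (λ P → ∃[ r ] Q r P)
  anyRuleᵉ {p} {j} {Q} Es =
    mapᵉ (λ (ℓ , r , _ , x) → r , x) (λ (r , x) → ruleName r , r , refl , x)
        (anyᵉ ≤-refl named)
    where
    named : ∀ ℓ → Expressible p (λ P → ∃[ r ] ruleName r ≡ ℓ × Q r P)
    -- The instance named by `ℓ` is searched for while the formula is built. Injectivity of the
    -- naming leaves at most one, so the inner quantifier disappears; a label without an instance
    -- contributes `false`.
    named ℓ with anyRule? {φ = φ} {j = j} (λ r → ruleName r ≟ᶠ ℓ)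
    ... | yes (r , refl) =
      mapᵉ (λ x → r , refl , x) (λ { {P} (r′ , e , x) → subst (λ r → Q r P) (ruleName-inj e) x }) (Es r)
    ... | no none = mapᵉ (λ ()) (λ (r , e , _) → none (r , e)) (fixed (no λ ()))

  allRuleᵉ : ∀ {p j} {Q : Rule φ j → Path N h → Set} → (∀ r → Expressible p (Q r)) →
             Expressible (labelsᵇ ⊗ (con 1 ⊕ p)) (λ P → ∀ r → Q r P)
  allRuleᵉ {p} {j} {Q} Es =
    mapᵉ (λ f r → f (ruleName r) r refl) (λ f _ r _ → f r)
        (allᵉ ≤-refl named)
    where
    named : ∀ ℓ → Expressible p (λ P → ∀ r → ruleName r ≡ ℓ → Q r P)
    named ℓ with anyRule? {φ = φ} {j = j} (λ r → ruleName r ≟ᶠ ℓ)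
    ... | yes (r , refl) =
      mapᵉ (λ {P} x r′ e → subst (λ r → Q r P) (ruleName-inj (sym e)) x) (λ f → f r refl) (Es r)
    -- Here a label without an instance contributes `true`, the neutral element of conjunction.
    ... | no none = mapᵉ (λ _ r e → contradiction (r , e) none) (λ _ → tt) (fixed (yes tt))

  arity≤2 : ∀ {j} (r : Rule φ j) → arity r ≤ 2
  arity≤2 rep           = s≤s z≤n
  arity≤2 (intro _ _ _) = s≤s z≤n
  arity≤2 (elim _ _ _)  = ≤-refl

  ruleActive : ∀ i j r → Expressible ruleActiveᵇ (λ P → RuleActive ν P i j r)
  ruleActive i j r = allᵉ (arity≤2 r) λ q → anyᵉ ≤-refl λ o → anyᵉ ≤-refl λ s → anyᵉ ≤-refl λ ℓ →
    -- Once source and label are given, activation of a position no longer depends on the path.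
    arrives o i j s ℓ ×ᵉ fixed ((name j (r , q) ≟ᶠ ℓ) ×-dec (s ≟ᶠ premise r q))

  uniquelyActive : ∀ i j r → Expressible uniqueᵇ (λ P → UniquelyActive ν P i j r)
  uniquelyActive i j r =
    ruleActive i j r ×ᵉ allRuleᵉ λ r′ → ruleActive i j r′ →ᵉ fixed (r′ ≟ʳ r)

  determined : ∀ i j → Expressible determinedᵇ (λ P → Determined ν P i j)
  determined i j = anyRuleᵉ λ r → uniquelyActive i j r ×ᵉ
    allᵉ ≤-refl λ o → allᵉ ≤-refl λ s → allᵉ ≤-refl λ ℓ →
      arrives o i j s ℓ →ᵉ fixed (any? λ q → (name j (r , q) ≟ᶠ ℓ) ×-dec (s ≟ᶠ premise r q))

  -- Dependency vectors of the next level

  resultBit : ∀ {j} (r : Rule φ j) k →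
              Expressible (con 1) (λ P → lookup (result r (λ q → d P (premise r q))) k ≡ true)
  resultBit {j} rep k = bitIs (inj₂ (j , k)) (λ P → refl) true
  resultBit (intro α b _) k = record
    -- The vector `χ α` is known when the circuit is built, so its negated bit is a constant.
    { expr = var (inj₂ (b , k)) ∧ᵉ const (not (lookup (χ {φ = φ} α) k)) ; small = ≤-refl
    ; reflects = λ P → subst (λ v → Reflects (v ≡ true)
                                      (lookup (d P b) k ∧ not (lookup (χ {φ = φ} α) k)))
                             (sym (lookup-zipWith _ k (d P b) (χ {φ = φ} α))) (≡true-reflects _) }
  resultBit (elim a b _) k = record
    { expr = var (inj₂ (a , k)) ∨ᵉ var (inj₂ (b , k)) ; small = ≤-refl
    ; reflects = λ P → subst (λ v → Reflects (v ≡ true) (lookup (d P a) k ∨ lookup (d P b) k))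
                             (sym (lookup-zipWith _ k (d P a) (d P b))) (≡true-reflects _) }

  -- The case distinction of `nextVec` becomes a disjunction over all instances. At most one of them
  -- can be uniquely active, and if none is, the empty disjunction agrees with the default
  -- `zeroVec`.
  NextBit : Fin h → Fin N → Fin N → Path N h → Set
  NextBit i j k P =
    ∃[ r ] UniquelyActive ν P i j r × lookup (result r (λ q → d P (premise r q))) k ≡ true

  nextVec⇒ : ∀ i j k {P} → lookup (nextVec ν P (d P) i j) k ≡ true → NextBit i j k P
  nextVec⇒ i j k {P} e with anyRule? (uniquelyActive? ν P i j)
  ... | yes (r , u) = r , u , e
  ... | no _        = contradiction (trans (sym e) (lookup-replicate k false)) λ ()

  nextVec⇐ : ∀ i j k {P} → NextBit i j k P → lookup (nextVec ν P (d P) i j) k ≡ true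
  nextVec⇐ i j k {P} (r , u , e) with anyRule? (uniquelyActive? ν P i j)
  ... | yes (r′ , u′) =
    -- The instance found by the search need not be `r` syntactically; the uniqueness half of `u′`
    -- identifies them.
    subst (λ r → lookup (result r (λ q → d P (premise r q))) k ≡ true) (proj₂ u′ r (proj₁ u)) e
  ... | no none       = contradiction (r , u) none

  nextBit : ∀ i j k → Expressible nextᵇ (λ P → lookup (nextVec ν P (d P) i j) k ≡ true)
  nextBit i j k = mapᵉ (nextVec⇐ i j k) (nextVec⇒ i j k)
    (anyRuleᵉ λ r → uniquelyActive i j r ×ᵉ resultBit r k)

  -- When `d` is taken to be the vectors of level `h`, the last equation is `Discharged` and the
  -- whole is `Accepts`.
  accepted : ∀ c → Expressible acceptsᵇ
    (λ P → Invalid ν P ⊎ (WellFormed ν P × d P c ≡ zeroVec))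
  accepted c =
    (anyᵉ h≤N λ i → anyᵉ ≤-refl λ j → cellActive i j ×ᵉ notᵉ (determined i j))
    ⊎ᵉ
    ((allᵉ h≤N λ i → allᵉ ≤-refl λ j → cellActive i j →ᵉ determined i j)
     ×ᵉ wordIs (λ k → inj₂ (c , k)) (λ k P → refl) ≤-refl zeroVec)

-- Sharing the dependency vectors of each level

module Realization {n} {A : Set} (enc : A → Vec Bool n) {V : Set} {ρ : A → V → Bool} {N : ℕ} where

  open Compilation enc
  open Expressibility ρ N

  -- The formula and `f` both reflect `Q`, so `det` forces their values to agree.
  realize : ∀ {p Q f g} {gs : Gates n g} → Sources gs → Expressible p Q →
            (∀ a → Reflects (Q a) (f a)) → Extension gs (⟦ p ⟧ N) {⊤} (λ _ → f)
  realize {gs = gs} S E r = record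
    { gates⁺ = gates⁺ F ; extends = extends F
    ; bounded = ≤-trans (bounded F) (+-monoˡ-≤ _ (small E)) ; source = source F
    ; computes = λ _ a → trans (computes F tt a) (det (reflects E a) (r a)) }
    where F = compile gs S (expr E)

  realizeMatrix : ∀ {p k l g} {gs : Gates n g} {f : Fin k × Fin l → A → Bool} → Sources gs →
                  (∀ ij → Expressible p (λ a → f ij a ≡ true)) →
                  Extension gs (k * l * ⟦ p ⟧ N) f
  realizeMatrix {p} {k} {l} {gs = gs} {f} S Es = record
    { gates⁺ = gates⁺ F ; extends = extends F ; bounded = bounded F
    -- Matrix entries are compiled in row-major order as a single family, and `remQuot-combine`
    -- recovers the pair.
    ; source = λ (i , j) → source F (combine i j)
    ; computes = λ (i , j) → subst (Computes (gates⁺ F) (source F (combine i j)) ∘ f)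
        (remQuot-combine i j)
        (λ a → trans (computes F (combine i j) a)
                     (det (reflects (Es (remQuot l (combine i j))) a) (≡true-reflects _))) }
    where
    F = compileAll gs S (⟦ p ⟧ N) (λ i → expr (Es (remQuot l i))) (λ i → small (Es (remQuot l i)))

module LevelCircuits {N h : ℕ} (h≤N : h ≤ N) {φ : Fin N → Formula} (ν : Naming φ) where

  open Compilation (encode {N} {h})
  open Realization (encode {N} {h})

  depBit : ∀ i → i ≤ h → Fin N × Fin N → Path N h → Bool
  depBit i i≤h (j , k) P = lookup (depVec ν P i i≤h j) k

  module At (i : ℕ) (i≤h : i ≤ h) = PathPredicates h≤N ν (λ P → depVec ν P i i≤h)

  levelSize : ℕ
  levelSize = N * N * ⟦ nextᵇ ⟧ N

  -- Path bits come from the circuit inputs; dependency bits come from gates already built, which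
  -- any number of later formulas may read.
  sources : ∀ i i≤h {k} (E : Extension [] k (depBit i i≤h)) →
            Sources {ρ = At.env i i≤h} (gates⁺ E)
  sources i i≤h E (inj₁ k)  = input k , λ _ → refl
  sources i i≤h E (inj₂ jk) = source E jk , computes E jk

  depCircuit : ∀ i (i≤h : i ≤ h) → Extension [] (i * levelSize) (depBit i i≤h)
  depCircuit zero i≤h = record
    { gates⁺ = [] ; extends = ⊑-refl ; bounded = ≤-refl
    -- The vectors of level 0 do not depend on the path, so they need no gates.
    ; source = λ (j , k) → constant (lookup (oneHot j) k) ; computes = λ _ _ → refl }
  depCircuit (suc i) i<h =
    E ⨾ realizeMatrix (sources i (<⇒≤ i<h) E) (λ (j , k) → At.nextBit i (<⇒≤ i<h) (fromℕ< i<h) j k)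
    where E = depCircuit i (<⇒≤ i<h)

  circuit : ∀ c → ∃[ C ] (size C ≤ h * levelSize + ⟦ acceptsᵇ ⟧ N ×
                          (∀ (P : Path N h) → evalCircuit C (encode P) ≡ acc ν c P))
  circuit c = record { size = total F ; gates = gates⁺ F ; output = source F tt } ,
    -- The construction starts from the empty gate list, which is the summand zero removed here.
    subst (total F ≤_) (trans (+-identityʳ _) (+-comm (⟦ acceptsᵇ ⟧ N) _)) (bounded F) ,
    computes F tt
    where
    E = depCircuit h ≤-refl
    F = E ⨾ realize (sources h ≤-refl E) (At.accepted h ≤-refl c) (λ P → ⌊⌋-reflects (accepts? ν P c))

-- The leading `X` bounds the number of transitions, and `X ⊗ X` counts the dependency bits of one
-- level.
sizeᵇ : Bound
sizeᵇ = X ⊗ (X ⊗ X ⊗ nextᵇ) ⊕ acceptsᵇ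

mainTheorem2 : ∃[ p ] (∀ (N : ℕ) → 1 ≤ N →
    (Γ : OrderedFormulaSet) (D : DLDS Γ) (L : LabelListing D N)
    (ν : Naming (LabelListing.φ L)) →
    (h : ℕ) → 1 ≤ h → h ≤ N →
    (c : Fin N) →
    ∃[ C ] (size C ≤ evalPoly p N ×
    (∀ (P : Path N h) → evalCircuit C (encode P) ≡ acc ν c P)))
mainTheorem2 = toPoly sizeᵇ , λ N _ Γ D L ν h _ h≤N c →
  let open LevelCircuits h≤N ν
      C , C≤ , correct = circuit c
  in C , subst (size C ≤_) (sym (evalPoly-toPoly sizeᵇ N))
           -- Replacing `h` by `N` makes the bound a function of `N` alone.
           (≤-trans C≤ (+-monoˡ-≤ _ (*-monoˡ-≤ levelSize h≤N))) , correct
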